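{- For every integer $n\ge 0$, the Lucas-Fubini number $\mathcal{L}_n$ is given by $$\mathcal{L}_n = \sum_{k=0}^{n}\sum_{j=0}^{k}(-1)^{k-j}\binom{k}{j}\frac{\alpha^{k+1}+\beta^{k+1}}{k!}\, j^n .$$
   Context: $\alpha=(1+\sqrt5)/2$ and $\beta=(1-\sqrt5)/2$. Convention: $0^0=1$. ${n\brace k}$ denotes the Stirling number of the second kind (the number of partitions of an $n$-element set into exactly $k$ non-empty blocks). $L_m$ denotes the Lucas numbers: $L_0=2$, $L_1=1$, $L_m=L_{m-1}+L_{m-2}$ for $m\ge2$. The Lucas-Fubini numbers are defined by $\mathcal{L}_n=\sum_{k=0}^n L_{k+1}{n\brace k}$ for $n\ge0$. -}

module Defs where

open import Algebra.Bundles using (RawMonoid; CommutativeRing)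
import Algebra.Definitions.RawMonoid
import Algebra.Properties.Semiring.Exp
open import Algebra.Structures using (IsCommutativeRing)
open import Data.Bool.Properties using () renaming (_≟_ to _≟ᵇ_)
open import Data.Fin.Base using (toℕ)
open import Data.Fin.Subset using (Subset; inside; outside; Nonempty; Empty; _∩_; ⋃; ⊤)
open import Data.Fin.Subset.Properties using (nonempty?)
open import Data.Integer.Base using (+_; 1ℤ)
open import Data.List.Base using (List; []; _∷_; _++_; map; filter; length)
open import Data.List.Relation.Unary.All using (All; all?)
open import Data.List.Relation.Unary.AllPairs using (AllPairs; allPairs?)
open import Data.Nat.Base as ℕ using (ℕ; zero; suc; NonZero)
open import Data.Product.Base using (_×_; _,_)
open import Data.Rational.Base as ℚ using (ℚ; 0ℚ; 1ℚ)
import Data.Rational.Properties as ℚ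
open import Data.Rational.Solver using (module +-*-Solver)
open import Data.Vec.Base using ([]; _∷_)
open import Data.Vec.Properties using (≡-dec)
open import Level using (0ℓ)
open import Relation.Binary.PropositionalEquality
  using (_≡_; refl; cong₂; isEquivalence)
open import Relation.Nullary.Decidable using (Dec; map′; ¬?; _×-dec_)

module BoundedSum {c ℓ} (M : RawMonoid c ℓ) where
  open RawMonoid M using (Carrier)
  open Algebra.Definitions.RawMonoid M using (sum)

  sum≤ : ℕ → (ℕ → Carrier) → Carrier
  sum≤ n f = sum {suc n} (λ i → f (toℕ i))

  infixl 10 sum≤
  syntax sum≤ n (λ k → t) = ∑[ k ≤ n ] t

subsets : ∀ n → List (Subset n)
subsets zero    = [] ∷ []
subsets (suc n) = map (outside ∷_) (subsets n) ++ map (inside ∷_) (subsets n)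

-- All ways of choosing k entries of a list, order disregarded.  Since `subsets n`
-- has no repetitions, `choose k (subsets n)` lists each set of k subsets once.
choose : ∀ {A : Set} → ℕ → List A → List (List A)
choose zero    xs       = [] ∷ []
choose (suc k) []       = []
choose (suc k) (x ∷ xs) = map (x ∷_) (choose k xs) ++ choose (suc k) xs

record IsPartition {n} (blocks : List (Subset n)) : Set where
  constructor isPartition
  field
    nonempty : All Nonempty blocks
    disjoint : AllPairs (λ p q → Empty (p ∩ q)) blocks
    covering : ⋃ blocks ≡ ⊤

isPartition? : ∀ {n} (blocks : List (Subset n)) → Dec (IsPartition blocks)
isPartition? blocks = map′ (λ (p , q , r) → isPartition p q r)
                           (λ (isPartition p q r) → p , q , r)
  (all? nonempty? blocks
    ×-dec allPairs? (λ p q → ¬? (nonempty? (p ∩ q))) blocks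
    ×-dec ≡-dec _≟ᵇ_ (⋃ blocks) ⊤)

partitions : ∀ n → ℕ → List (List (Subset n))
partitions n k = filter isPartition? (choose k (subsets n))

stirling₂ : ℕ → ℕ → ℕ
stirling₂ n k = length (partitions n k)

lucas : ℕ → ℕ
lucas 0             = 2
lucas 1             = 1
lucas (suc (suc m)) = lucas (suc m) ℕ.+ lucas m

lucasFubini : ℕ → ℕ
lucasFubini n = ∑[ k ≤ n ] (lucas (suc k) ℕ.* stirling₂ n k)
  where open BoundedSum ℕ.+-0-rawMonoid

-- The subfield ℚ(√5) of ℝ: a +√5· b stands for the real number a + b√5.  As √5 is
-- irrational, distinct pairs are distinct reals, so _≡_ is equality of real numbers.
infix 5 _+√5·_

record ℚ[√5] : Set where
  constructor _+√5·_
  field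
    rational   : ℚ
    irrational : ℚ

fromℚ : ℚ → ℚ[√5]
fromℚ q = q +√5· 0ℚ

fromℕ : ℕ → ℚ[√5]
fromℕ n = fromℚ (+ n ℚ./ 1)

√5 0# 1# : ℚ[√5]
√5 = 0ℚ +√5· 1ℚ
0# = fromℚ 0ℚ
1# = fromℚ 1ℚ

infixl 6 _+_ _-_
infixl 7 _*_ _/_
infix  8 -_

_+_ _*_ : ℚ[√5] → ℚ[√5] → ℚ[√5]

(a +√5· b) + (c +√5· d) = (a ℚ.+ c) +√5· (b ℚ.+ d)
(a +√5· b) * (c +√5· d) =
  (a ℚ.* c ℚ.+ (+ 5 ℚ./ 1) ℚ.* (b ℚ.* d)) +√5· (a ℚ.* d ℚ.+ b ℚ.* c)

-_ : ℚ[√5] → ℚ[√5]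
- (a +√5· b) = (ℚ.- a) +√5· (ℚ.- b)

_-_ : ℚ[√5] → ℚ[√5] → ℚ[√5]
x - y = x + (- y)

_/_ : ℚ[√5] → (d : ℕ) .{{_ : NonZero d}} → ℚ[√5]
x / d = x * fromℚ (1ℤ ℚ./ d)

+-*-isCommutativeRing : IsCommutativeRing _≡_ _+_ _*_ -_ 0# 1#
+-*-isCommutativeRing = record
  { isRing = record
    { +-isAbelianGroup = record
      { isGroup = record
        { isMonoid = record
          { isSemigroup = record
            { isMagma = record { isEquivalence = isEquivalence ; ∙-cong = cong₂ _+_ }
            ; assoc = λ (a +√5· b) (c +√5· d) (e +√5· f) →
                cong₂ _+√5·_ (ℚ.+-assoc a c e) (ℚ.+-assoc b d f)
            }
          ; identity = (λ (a +√5· b) → cong₂ _+√5·_ (ℚ.+-identityˡ a) (ℚ.+-identityˡ b))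
                     , (λ (a +√5· b) → cong₂ _+√5·_ (ℚ.+-identityʳ a) (ℚ.+-identityʳ b))
          }
        ; inverse = (λ (a +√5· b) → cong₂ _+√5·_ (ℚ.+-inverseˡ a) (ℚ.+-inverseˡ b))
                  , (λ (a +√5· b) → cong₂ _+√5·_ (ℚ.+-inverseʳ a) (ℚ.+-inverseʳ b))
        ; ⁻¹-cong = λ { refl → refl }
        }
      ; comm = λ (a +√5· b) (c +√5· d) → cong₂ _+√5·_ (ℚ.+-comm a c) (ℚ.+-comm b d)
      }
    ; *-cong = cong₂ _*_
    ; *-assoc = λ (a +√5· b) (c +√5· d) (e +√5· f) → cong₂ _+√5·_
        (solve 7 (λ s a b c d e f →
            (a :* c :+ s :* (b :* d)) :* e :+ s :* ((a :* d :+ b :* c) :* f)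
         := a :* (c :* e :+ s :* (d :* f)) :+ s :* (b :* (c :* f :+ d :* e)))
          refl (+ 5 ℚ./ 1) a b c d e f)
        (solve 7 (λ s a b c d e f →
            (a :* c :+ s :* (b :* d)) :* f :+ (a :* d :+ b :* c) :* e
         := a :* (c :* f :+ d :* e) :+ b :* (c :* e :+ s :* (d :* f)))
          refl (+ 5 ℚ./ 1) a b c d e f)
    ; *-identity =
        (λ (a +√5· b) → cong₂ _+√5·_
          (solve 3 (λ s a b → con 1ℚ :* a :+ s :* (con 0ℚ :* b) := a) refl (+ 5 ℚ./ 1) a b)
          (solve 2 (λ a b → con 1ℚ :* b :+ con 0ℚ :* a := b) refl a b))
      , (λ (a +√5· b) → cong₂ _+√5·_
          (solve 3 (λ s a b → a :* con 1ℚ :+ s :* (b :* con 0ℚ) := a) refl (+ 5 ℚ./ 1) a b)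
          (solve 2 (λ a b → a :* con 0ℚ :+ b :* con 1ℚ := b) refl a b))
    ; distrib =
        (λ (a +√5· b) (c +√5· d) (e +√5· f) → cong₂ _+√5·_
          (solve 7 (λ s a b c d e f →
              a :* (c :+ e) :+ s :* (b :* (d :+ f))
           := (a :* c :+ s :* (b :* d)) :+ (a :* e :+ s :* (b :* f)))
            refl (+ 5 ℚ./ 1) a b c d e f)
          (solve 6 (λ a b c d e f →
              a :* (d :+ f) :+ b :* (c :+ e)
           := (a :* d :+ b :* c) :+ (a :* f :+ b :* e))
            refl a b c d e f))
      , (λ (a +√5· b) (c +√5· d) (e +√5· f) → cong₂ _+√5·_
          (solve 7 (λ s a b c d e f →
              (c :+ e) :* a :+ s :* ((d :+ f) :* b)
           := (c :* a :+ s :* (d :* b)) :+ (e :* a :+ s :* (f :* b)))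
            refl (+ 5 ℚ./ 1) a b c d e f)
          (solve 6 (λ a b c d e f →
              (c :+ e) :* b :+ (d :+ f) :* a
           := (c :* b :+ d :* a) :+ (e :* b :+ f :* a))
            refl a b c d e f))
    }
  ; *-comm = λ (a +√5· b) (c +√5· d) → cong₂ _+√5·_
      (solve 5 (λ s a b c d → a :* c :+ s :* (b :* d) := c :* a :+ s :* (d :* b))
        refl (+ 5 ℚ./ 1) a b c d)
      (solve 4 (λ a b c d → a :* d :+ b :* c := c :* b :+ d :* a) refl a b c d)
  }
  where open +-*-Solver

ℚ[√5]-commutativeRing : CommutativeRing 0ℓ 0ℓ
ℚ[√5]-commutativeRing = record { isCommutativeRing = +-*-isCommutativeRing }

open CommutativeRing ℚ[√5]-commutativeRing using (semiring; +-rawMonoid)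
open Algebra.Properties.Semiring.Exp semiring public using (_^_)
open BoundedSum +-rawMonoid public

√5*√5≡5 : √5 * √5 ≡ fromℕ 5
√5*√5≡5 = refl

α β : ℚ[√5]
α = (1# + √5) / 2
β = (1# - √5) / 2

module Submission where

-- Let P n k x be the number of k-element sets of pairwise disjoint nonempty subsets of an
-- n-set, each counted with weight x to the number of uncovered points.  At x = 0 only the
-- partitions survive (0⁰ = 1), so P n k 0 is the Stirling number.  Conditioning on the fate
-- of the first point gives P (n+1) (k+1) x = x P n (k+1) x + P n k (x+1): it is either
-- uncovered, or added to a subset of the uncovered points, and summing over such subsets
-- turns x into x + 1.  By the Leibniz rule for x · xⁿ, the k-th finite difference of xⁿ
-- obeys the recurrence of k! P n k x.  Binet's formula for Lucas numbers does the rest.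

open import Algebra.Bundles using (CommutativeRing)
open import Data.Nat.Base as ℕ using (ℕ; zero; suc; _∸_; _!)
open import Data.Nat.Combinatorics using (_C_)
open import Data.Nat.Properties as ℕ using (_!≢0)
open import Relation.Binary.PropositionalEquality as ≡ using (_≡_)
open import Defs
  using (module BoundedSum; subsets; choose; stirling₂; isPartition; isPartition?; lucas)

module Packings where

  open import Algebra.Properties.CommutativeSemigroup using (interchange; x∙yz≈y∙xz; xy∙z≈y∙xz)
  open import Data.Bool.Base using (true; false; if_then_else_)
  open import Data.Bool.Properties using () renaming (_≟_ to _≟ᵇ_)
  open import Data.Fin.Base using (zero; suc)
  open import Data.Fin.Subset
    using (Subset; inside; outside; Nonempty; Empty; _∩_; _∪_; ∁; ⋃; ∣_∣; ⊤)
  open import Data.Fin.Subset.Properties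
    using ( nonempty?; drop-there; x∈p∩q⁺; x∈p∩q⁻; x∈p∪q⁺; x∈p∪q⁻
          ; ∪-assoc; ∪-identityˡ; ∪-identityʳ; ∉⊥)
  open import Data.List.Base using (List; []; _∷_; [_]; _++_; _∷ʳ_; map; filter; length)
  open import Data.List.Properties using (map-++; map-∘; map-cong)
  open import Data.List.Relation.Unary.All as All using (All; []; _∷_; all?)
  import Data.List.Relation.Unary.All.Properties as All
  open import Data.List.Relation.Unary.AllPairs as AllPairs using (AllPairs; []; _∷_; allPairs?)
  import Data.List.Relation.Unary.AllPairs.Properties as AllPairs
  open import Data.Nat.Base using (_+_; _*_; _^_)
  open import Data.Nat.ListAction using (sum)
  open import Data.Nat.ListAction.Properties using (sum-++)
  open import Data.Nat.Properties using
    ( +-assoc; +-comm; +-identityʳ; *-identityˡ; *-distribˡ-+; *-zeroʳ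
    ; +-commutativeSemigroup; *-commutativeSemigroup)
  open import Data.Product.Base using (_×_; _,_; proj₁; proj₂)
  open import Data.Sum.Base using (inj₁; inj₂)
  open import Data.Vec.Base using ([]; _∷_; here; there)
  open import Data.Vec.Properties using (≡-dec; ∷-injectiveʳ)
  open import Function.Base using (_∘_)
  open import Function.Bundles using (_⇔_; mk⇔; Equivalence)
  open import Relation.Binary.PropositionalEquality
    using (refl; sym; trans; cong; cong₂; module ≡-Reasoning)
  open import Relation.Nullary.Decidable using (Dec; does; ¬?; _×-dec_; does-⇔; dec-false)
  open import Relation.Nullary.Negation using (¬_)

  open ≡-Reasoning
  open Equivalence using (to; from)

  private variable
    A B : Set
    n : ℕ

  -- Sums over lists and over all choices of k entries of a list.

  ∑ : List A → (A → ℕ) → ℕ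
  ∑ xs f = sum (map f xs)

  ∑-++ : ∀ (f : A → ℕ) xs ys → ∑ (xs ++ ys) f ≡ ∑ xs f + ∑ ys f
  ∑-++ f xs ys = trans (cong sum (map-++ f xs ys)) (sum-++ (map f xs) (map f ys))

  ∑-map : ∀ (f : B → ℕ) (g : A → B) xs → ∑ (map g xs) f ≡ ∑ xs (f ∘ g)
  ∑-map f g xs = cong sum (sym (map-∘ xs))

  ∑-cong : ∀ {f g : A → ℕ} → (∀ x → f x ≡ g x) → ∀ xs → ∑ xs f ≡ ∑ xs g
  ∑-cong f≗g xs = cong sum (map-cong f≗g xs)

  ∑-*ˡ : ∀ c (f : A → ℕ) xs → ∑ xs (λ x → c * f x) ≡ c * ∑ xs f
  ∑-*ˡ c f []       = sym (*-zeroʳ c)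
  ∑-*ˡ c f (x ∷ xs) = trans (cong (c * f x +_) (∑-*ˡ c f xs)) (sym (*-distribˡ-+ c (f x) _))

  ∑-choose-∷ : ∀ k (x : A) xs (w : List A → ℕ) →
    ∑ (choose (suc k) (x ∷ xs)) w ≡ ∑ (choose k xs) (w ∘ (x ∷_)) + ∑ (choose (suc k) xs) w
  ∑-choose-∷ k x xs w = trans (∑-++ w (map (x ∷_) (choose k xs)) _)
    (cong (_+ ∑ (choose (suc k) xs) w) (∑-map w (x ∷_) (choose k xs)))

  module _ (g : A → B) where

    -- Every choice of at least one entry of `map g ys` begins with some `g y`.
    ∑-choose-vanish₁ : ∀ k ys (w : List B → ℕ) → (∀ y zs → w (g y ∷ zs) ≡ 0) →
      ∑ (choose (suc k) (map g ys)) w ≡ 0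
    ∑-choose-vanish₁ k []       w w≡0 = refl
    ∑-choose-vanish₁ k (y ∷ ys) w w≡0 = trans (∑-choose-∷ k (g y) (map g ys) w)
      (cong₂ _+_ (trans (∑-cong (w≡0 y) (choose k (map g ys)))
                        (∑-*ˡ 0 (λ _ → 0) (choose k (map g ys))))
                 (∑-choose-vanish₁ k ys w w≡0))

    ∑-choose-vanish₂ : ∀ k ys (w : List B → ℕ) → (∀ y y′ zs → w (g y ∷ g y′ ∷ zs) ≡ 0) →
      ∑ (choose (suc (suc k)) (map g ys)) w ≡ 0
    ∑-choose-vanish₂ k []       w w≡0 = refl
    ∑-choose-vanish₂ k (y ∷ ys) w w≡0 = trans (∑-choose-∷ (suc k) (g y) (map g ys) w)
      (cong₂ _+_ (∑-choose-vanish₁ k ys (w ∘ (g y ∷_)) (w≡0 y)) (∑-choose-vanish₂ k ys w w≡0))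

    ∑-choose-1 : ∀ ys (w : List B → ℕ) → ∑ (choose 1 (map g ys)) w ≡ ∑ ys (λ y → w [ g y ])
    ∑-choose-1 []       w = refl
    ∑-choose-1 (y ∷ ys) w = trans (∑-choose-∷ 0 (g y) (map g ys) w)
      (cong₂ _+_ (+-identityʳ (w [ g y ])) (∑-choose-1 ys w))

  -- `choose` keeps the order of the list, so the entries taken from `map g ys` stand at the end of
  -- each choice. As `w` vanishes whenever two of them are adjacent, only choices with no such
  -- entry, or with a single one in last place, contribute.
  ∑-choose-split : ∀ (f g : A → B) k xs ys (w : List B → ℕ) →
    (∀ zs y y′ zs′ → w (zs ++ g y ∷ g y′ ∷ zs′) ≡ 0) →
    ∑ (choose (suc k) (map f xs ++ map g ys)) w ≡
      ∑ (choose (suc k) xs) (w ∘ map f)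
        + ∑ (choose k xs) (λ zs → ∑ ys (λ y → w (map f zs ∷ʳ g y)))
  ∑-choose-split f g zero    [] ys w w≡0 = trans (∑-choose-1 g ys w) (sym (+-identityʳ _))
  -- With no entries from `f`, at least two must come from `g`.
  ∑-choose-split f g (suc k) [] ys w w≡0 = ∑-choose-vanish₂ g k ys w (w≡0 [])
  ∑-choose-split f g zero (x ∷ xs) ys w w≡0 = begin
    ∑ (choose 1 (f x ∷ map f xs ++ map g ys)) w
      ≡⟨ ∑-choose-∷ 0 (f x) (map f xs ++ map g ys) w ⟩
    (w [ f x ] + 0) + ∑ (choose 1 (map f xs ++ map g ys)) w
      ≡⟨ cong ((w [ f x ] + 0) +_) (∑-choose-split f g 0 xs ys w w≡0) ⟩
    (w [ f x ] + 0) + (∑ (choose 1 xs) (w ∘ map f) + h)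
      ≡⟨ +-assoc (w [ f x ] + 0) _ h ⟨
    ((w [ f x ] + 0) + ∑ (choose 1 xs) (w ∘ map f)) + h
      ≡⟨ cong (_+ h) (∑-choose-∷ 0 x xs (w ∘ map f)) ⟨
    ∑ (choose 1 (x ∷ xs)) (w ∘ map f) + h ∎
    where
    h = ∑ (choose 0 xs) (λ zs → ∑ ys (λ y → w (map f zs ∷ʳ g y)))
  ∑-choose-split {A = A} f g (suc k) (x ∷ xs) ys w w≡0 = begin
    ∑ (choose (suc (suc k)) (f x ∷ zs)) w
      ≡⟨ ∑-choose-∷ (suc k) (f x) zs w ⟩
    ∑ (choose (suc k) zs) (w ∘ (f x ∷_)) + ∑ (choose (suc (suc k)) zs) w
      ≡⟨ cong₂ _+_ (∑-choose-split f g k xs ys (w ∘ (f x ∷_)) (w≡0 ∘ (f x ∷_)))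
                   (∑-choose-split f g (suc k) xs ys w w≡0) ⟩
    (∑ (choose (suc k) xs) (w ∘ map f ∘ (x ∷_)) + ∑ (choose k xs) (h ∘ (x ∷_)))
      + (∑ (choose (suc (suc k)) xs) (w ∘ map f) + ∑ (choose (suc k) xs) h)
      ≡⟨ interchange +-commutativeSemigroup (∑ (choose (suc k) xs) (w ∘ map f ∘ (x ∷_))) _ _ _ ⟩
    (∑ (choose (suc k) xs) (w ∘ map f ∘ (x ∷_)) + ∑ (choose (suc (suc k)) xs) (w ∘ map f))
      + (∑ (choose k xs) (h ∘ (x ∷_)) + ∑ (choose (suc k) xs) h)
      ≡⟨ cong₂ _+_ (∑-choose-∷ (suc k) x xs (w ∘ map f)) (∑-choose-∷ k x xs h) ⟨
    ∑ (choose (suc (suc k)) (x ∷ xs)) (w ∘ map f) + ∑ (choose (suc k) (x ∷ xs)) h ∎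
    where
    zs = map f xs ++ map g ys
    h : List A → ℕ
    h cs = ∑ ys (λ y → w (map f cs ∷ʳ g y))

  -- Iverson brackets.

  ⟦_⟧ : Dec A → ℕ
  ⟦ a? ⟧ = if does a? then 1 else 0

  ⟦⟧-⇔ : A ⇔ B → (a? : Dec A) (b? : Dec B) → ⟦ a? ⟧ ≡ ⟦ b? ⟧
  ⟦⟧-⇔ A⇔B a? b? = cong (if_then 1 else 0) (does-⇔ A⇔B a? b?)

  ⟦⟧-× : (a? : Dec A) (b? : Dec B) → ⟦ a? ×-dec b? ⟧ ≡ ⟦ a? ⟧ * ⟦ b? ⟧
  ⟦⟧-× a? b? with does a?
  ... | true  = sym (*-identityˡ ⟦ b? ⟧)
  ... | false = refl

  ⟦⟧-false : (a? : Dec A) → ¬ A → ⟦ a? ⟧ ≡ 0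
  ⟦⟧-false a? ¬a = cong (if_then 1 else 0) (dec-false a? ¬a)

  length-filter : ∀ {P : A → Set} (P? : ∀ x → Dec (P x)) xs →
    length (filter P? xs) ≡ ∑ xs (λ x → ⟦ P? x ⟧)
  length-filter P? []       = refl
  length-filter P? (x ∷ xs) with does (P? x)
  ... | true  = cong suc (length-filter P? xs)
  ... | false = length-filter P? xs

  -- Packings (families of disjoint nonempty subsets) and the effect of adding a point.

  Disjoint : Subset n → Subset n → Set
  Disjoint p q = Empty (p ∩ q)

  disjoint? : (p q : Subset n) → Dec (Disjoint p q)
  disjoint? p q = ¬? (nonempty? (p ∩ q))

  IsPacking : List (Subset n) → Set
  IsPacking bs = All Nonempty bs × AllPairs Disjoint bs

  isPacking? : (bs : List (Subset n)) → Dec (IsPacking bs)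
  isPacking? bs = all? nonempty? bs ×-dec allPairs? disjoint? bs

  Nonempty-outside : {p : Subset n} → Nonempty p ⇔ Nonempty (outside ∷ p)
  Nonempty-outside = mk⇔ (λ (i , i∈p) → suc i , there i∈p) λ { (suc i , i∈) → i , drop-there i∈ }

  Empty-outside : {p : Subset n} → Empty p ⇔ Empty (outside ∷ p)
  Empty-outside = mk⇔ (_∘ from Nonempty-outside) (_∘ to Nonempty-outside)

  module _ {R : A → A → Set} where

    AllPairs-∷ʳ⁺ : ∀ {xs y} → AllPairs R xs → All (λ x → R x y) xs → AllPairs R (xs ∷ʳ y)
    AllPairs-∷ʳ⁺ rs r = AllPairs.++⁺ rs ([] ∷ []) (All.map (_∷ []) r)

    AllPairs-++⁻ʳ : ∀ xs {ys} → AllPairs R (xs ++ ys) → AllPairs R ys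
    AllPairs-++⁻ʳ []       rs       = rs
    AllPairs-++⁻ʳ (x ∷ xs) (_ ∷ rs) = AllPairs-++⁻ʳ xs rs

    AllPairs-∷ʳ⁻ : ∀ xs {y} → AllPairs R (xs ∷ʳ y) → AllPairs R xs × All (λ x → R x y) xs
    AllPairs-∷ʳ⁻ []       _        = [] , []
    AllPairs-∷ʳ⁻ (x ∷ xs) (r ∷ rs) with All.∷ʳ⁻ r | AllPairs-∷ʳ⁻ xs rs
    ... | rxs , rxy | rs′ , ry = (rxs ∷ rs′) , (rxy ∷ ry)

  Disjoint-⋃⁺ : ∀ (p : Subset n) {bs} → All (λ b → Disjoint b p) bs → Disjoint p (⋃ bs)
  Disjoint-⋃⁺ p {[]}     []       (i , i∈) = ∉⊥ (proj₂ (x∈p∩q⁻ p _ i∈))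
  Disjoint-⋃⁺ p {b ∷ bs} (d ∷ ds) (i , i∈) with x∈p∩q⁻ p _ i∈
  ... | i∈p , i∈⋃ with x∈p∪q⁻ b (⋃ bs) i∈⋃
  ... | inj₁ i∈b = d (i , x∈p∩q⁺ (i∈b , i∈p))
  ... | inj₂ i∈⋃bs = Disjoint-⋃⁺ p ds (i , x∈p∩q⁺ (i∈p , i∈⋃bs))

  Disjoint-⋃⁻ : ∀ (p : Subset n) bs → Disjoint p (⋃ bs) → All (λ b → Disjoint b p) bs
  Disjoint-⋃⁻ p []       d = []
  Disjoint-⋃⁻ p (b ∷ bs) d =
    (λ (i , i∈) → let (i∈b , i∈p) = x∈p∩q⁻ b p i∈ in d (i , x∈p∩q⁺ (i∈p , x∈p∪q⁺ (inj₁ i∈b))))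
    ∷ Disjoint-⋃⁻ p bs (λ (i , i∈) → let (i∈p , i∈⋃) = x∈p∩q⁻ p (⋃ bs) i∈ in
        d (i , x∈p∩q⁺ (i∈p , x∈p∪q⁺ (inj₂ i∈⋃))))

  IsPacking-outside : {bs : List (Subset n)} → IsPacking bs ⇔ IsPacking (map (outside ∷_) bs)
  IsPacking-outside = mk⇔
    (λ (ne , ds) → All.gmap⁺ (to Nonempty-outside) ne
                 , AllPairs.map⁺ (AllPairs.map (to Empty-outside) ds))
    (λ (ne , ds) → All.gmap⁻ (from Nonempty-outside) ne
                 , AllPairs.map (from Empty-outside) (AllPairs.map⁻ ds))

  -- The last block is the only one containing the first point. That point makes it nonempty even if
  -- `p` is empty, and disjointness from the other blocks is decided on the remaining points, that
  -- is, by `p` against their union.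
  IsPacking-∷ʳ-inside : {p : Subset n} {bs : List (Subset n)} →
    (Disjoint p (⋃ bs) × IsPacking bs) ⇔ IsPacking (map (outside ∷_) bs ∷ʳ (inside ∷ p))
  IsPacking-∷ʳ-inside {p = p} {bs} = mk⇔
    (λ (d , packing) → let (ne , ds) = to IsPacking-outside packing in
        All.∷ʳ⁺ ne (zero , here)
      , AllPairs-∷ʳ⁺ ds (All.gmap⁺ (to Empty-outside) (Disjoint-⋃⁻ p bs d)))
    (λ (ne , ds) → let (ds′ , d) = AllPairs-∷ʳ⁻ (map (outside ∷_) bs) ds in
        Disjoint-⋃⁺ p (All.gmap⁻ (from Empty-outside) d)
      , from IsPacking-outside (proj₁ (All.∷ʳ⁻ ne) , ds′))

  -- Two blocks share the first point.
  ¬IsPacking-inside-inside : ∀ bs (p q : Subset n) bs′ →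
    ¬ IsPacking (bs ++ (inside ∷ p) ∷ (inside ∷ q) ∷ bs′)
  ¬IsPacking-inside-inside bs p q bs′ (_ , ds) with AllPairs-++⁻ʳ bs ds
  ... | (d ∷ _) ∷ _ = d (zero , here)

  ⋃-outside : (bs : List (Subset n)) → ⋃ (map (outside ∷_) bs) ≡ outside ∷ ⋃ bs
  ⋃-outside []       = refl
  ⋃-outside (b ∷ bs) = cong ((outside ∷ b) ∪_) (⋃-outside bs)

  ⋃-∷ʳ : ∀ bs (p : Subset n) → ⋃ (bs ∷ʳ p) ≡ ⋃ bs ∪ p
  ⋃-∷ʳ []       p = trans (∪-identityʳ p) (sym (∪-identityˡ p))
  ⋃-∷ʳ (b ∷ bs) p = trans (cong (b ∪_) (⋃-∷ʳ bs p)) (sym (∪-assoc b (⋃ bs) p))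

  -- Weights of packings.

  weight : ℕ → List (Subset n) → ℕ
  weight x bs = ⟦ isPacking? bs ⟧ * x ^ ∣ ∁ (⋃ bs) ∣

  -- The first point stays uncovered and contributes one more factor `x`.
  weight-outside : ∀ x (bs : List (Subset n)) → weight x (map (outside ∷_) bs) ≡ x * weight x bs
  weight-outside x bs = begin
    ⟦ isPacking? (map (outside ∷_) bs) ⟧ * x ^ ∣ ∁ (⋃ (map (outside ∷_) bs)) ∣
      ≡⟨ cong₂ (λ a u → a * x ^ ∣ ∁ u ∣)
           (sym (⟦⟧-⇔ IsPacking-outside (isPacking? bs) (isPacking? (map (outside ∷_) bs))))
           (⋃-outside bs) ⟩
    ⟦ isPacking? bs ⟧ * (x * x ^ ∣ ∁ (⋃ bs) ∣)
      ≡⟨ x∙yz≈y∙xz *-commutativeSemigroup ⟦ isPacking? bs ⟧ x _ ⟩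
    x * weight x bs ∎

  -- Separates the factor that depends on `bs` alone from the one that `∑-disjoint` sums over `p`.
  weight-∷ʳ-inside : ∀ x (p : Subset n) bs → weight x (map (outside ∷_) bs ∷ʳ (inside ∷ p)) ≡
    ⟦ isPacking? bs ⟧ * (⟦ disjoint? p (⋃ bs) ⟧ * x ^ ∣ ∁ (⋃ bs ∪ p) ∣)
  weight-∷ʳ-inside x p bs = begin
    ⟦ isPacking? bs′ ⟧ * x ^ ∣ ∁ (⋃ bs′) ∣
      ≡⟨ cong₂ (λ a u → a * x ^ ∣ ∁ u ∣)
           (sym (⟦⟧-⇔ IsPacking-∷ʳ-inside
                      (disjoint? p (⋃ bs) ×-dec isPacking? bs) (isPacking? bs′)))
           (trans (⋃-∷ʳ (map (outside ∷_) bs) (inside ∷ p))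
                  (cong (_∪ (inside ∷ p)) (⋃-outside bs))) ⟩
    ⟦ disjoint? p (⋃ bs) ×-dec isPacking? bs ⟧ * x ^ ∣ ∁ (⋃ bs ∪ p) ∣
      ≡⟨ cong (_* x ^ ∣ ∁ (⋃ bs ∪ p) ∣) (⟦⟧-× (disjoint? p (⋃ bs)) (isPacking? bs)) ⟩
    ⟦ disjoint? p (⋃ bs) ⟧ * ⟦ isPacking? bs ⟧ * x ^ ∣ ∁ (⋃ bs ∪ p) ∣
      ≡⟨ xy∙z≈y∙xz *-commutativeSemigroup ⟦ disjoint? p (⋃ bs) ⟧ ⟦ isPacking? bs ⟧ _ ⟩
    ⟦ isPacking? bs ⟧ * (⟦ disjoint? p (⋃ bs) ⟧ * x ^ ∣ ∁ (⋃ bs ∪ p) ∣) ∎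
    where bs′ = map (outside ∷_) bs ∷ʳ (inside ∷ p)

  -- A binomial theorem, proved point by point: a point of `u` cannot lie in `p`, while a point
  -- outside `u` either joins `p` (factor 1) or stays uncovered (factor `x`), giving `suc x` in
  -- total.
  ∑-disjoint : ∀ x (u : Subset n) →
    ∑ (subsets n) (λ p → ⟦ disjoint? p u ⟧ * x ^ ∣ ∁ (u ∪ p) ∣) ≡ suc x ^ ∣ ∁ u ∣
  ∑-disjoint x []      = refl
  ∑-disjoint {n = suc n} x (s ∷ u) = begin
    ∑ (map (outside ∷_) (subsets n) ++ map (inside ∷_) (subsets n)) f
      ≡⟨ ∑-++ f (map (outside ∷_) (subsets n)) _ ⟩
    ∑ (map (outside ∷_) (subsets n)) f + ∑ (map (inside ∷_) (subsets n)) f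
      ≡⟨ cong₂ _+_ (∑-map f (outside ∷_) (subsets n)) (∑-map f (inside ∷_) (subsets n)) ⟩
    ∑ (subsets n) (f ∘ (outside ∷_)) + ∑ (subsets n) (f ∘ (inside ∷_))
      ≡⟨ split s ⟩
    suc x ^ ∣ ∁ (s ∷ u) ∣ ∎
    where
    weightOf : Subset n → ℕ
    weightOf p = x ^ ∣ ∁ (u ∪ p) ∣

    f : Subset (suc n) → ℕ
    f p = ⟦ disjoint? p (s ∷ u) ⟧ * x ^ ∣ ∁ ((s ∷ u) ∪ p) ∣

    ⟦⟧-outside : ∀ p → ⟦ ¬? (nonempty? (outside ∷ p ∩ u)) ⟧ ≡ ⟦ disjoint? p u ⟧
    ⟦⟧-outside p = sym (⟦⟧-⇔ Empty-outside (disjoint? p u) (¬? (nonempty? (outside ∷ p ∩ u))))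

    split : ∀ s → let g = λ p → ⟦ disjoint? p (s ∷ u) ⟧ * x ^ ∣ ∁ ((s ∷ u) ∪ p) ∣ in
      ∑ (subsets n) (g ∘ (outside ∷_)) + ∑ (subsets n) (g ∘ (inside ∷_)) ≡ suc x ^ ∣ ∁ (s ∷ u) ∣
    split inside = begin
      _ ≡⟨ cong₂ _+_
             (∑-cong (λ p → cong (_* weightOf p) (⟦⟧-outside p)) (subsets n))
             -- Both sets contain the first point, so every summand computes to 0.
             (∑-*ˡ 0 (λ _ → 0) (subsets n)) ⟩
      ∑ (subsets n) (λ p → ⟦ disjoint? p u ⟧ * weightOf p) + 0 ≡⟨ +-identityʳ _ ⟩
      ∑ (subsets n) (λ p → ⟦ disjoint? p u ⟧ * weightOf p)     ≡⟨ ∑-disjoint x u ⟩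
      suc x ^ ∣ ∁ u ∣ ∎
    split outside = begin
      _ ≡⟨ cong₂ _+_
             (∑-cong (λ p → trans (cong (_* (x * weightOf p)) (⟦⟧-outside p))
                                  (x∙yz≈y∙xz *-commutativeSemigroup ⟦ disjoint? p u ⟧ x (weightOf p)))
                     (subsets n))
             (∑-cong (λ p → cong (_* weightOf p) (⟦⟧-outside p)) (subsets n)) ⟩
      ∑ (subsets n) (λ p → x * (⟦ disjoint? p u ⟧ * weightOf p))
        + ∑ (subsets n) (λ p → ⟦ disjoint? p u ⟧ * weightOf p)
        ≡⟨ cong₂ _+_ (trans (∑-*ˡ x _ (subsets n)) (cong (x *_) (∑-disjoint x u)))
                     (∑-disjoint x u) ⟩
      x * suc x ^ ∣ ∁ u ∣ + suc x ^ ∣ ∁ u ∣ ≡⟨ +-comm (x * suc x ^ ∣ ∁ u ∣) _ ⟩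
      suc x * suc x ^ ∣ ∁ u ∣ ∎

  weight-inside-inside : ∀ x bs (p q : Subset n) bs′ →
    weight x (bs ++ (inside ∷ p) ∷ (inside ∷ q) ∷ bs′) ≡ 0
  weight-inside-inside x bs p q bs′ = cong (_* x ^ ∣ ∁ (⋃ bs″) ∣)
    (⟦⟧-false (isPacking? bs″) (¬IsPacking-inside-inside bs p q bs′))
    where bs″ = bs ++ (inside ∷ p) ∷ (inside ∷ q) ∷ bs′

  -- The numbers P n k x and their recurrence.

  packings : ℕ → ℕ → ℕ → ℕ
  packings n k x = ∑ (choose k (subsets n)) (weight x)

  packings-0-suc : ∀ k x → packings 0 (suc k) x ≡ 0
  packings-0-suc zero    x = refl
  packings-0-suc (suc k) x = refl

  packings-suc-0 : ∀ n x → packings (suc n) 0 x ≡ x * packings n 0 x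
  packings-suc-0 n x = begin
    weight {suc n} x [] + 0 ≡⟨ +-identityʳ _ ⟩
    -- The empty family is its own image under `map (outside ∷_)`.
    weight {suc n} x []     ≡⟨ weight-outside {n} x [] ⟩
    x * weight {n} x []     ≡⟨ cong (x *_) (+-identityʳ _) ⟨
    x * (weight {n} x [] + 0) ∎

  -- `subsets (suc n)` lists the subsets without the first point before those with it, as
  -- `∑-choose-split` requires. In the first sum the first point is uncovered; in the second it lies
  -- in the last block, whose remaining points `p` are summed over.
  packings-suc-suc : ∀ n k x →
    packings (suc n) (suc k) x ≡ x * packings n (suc k) x + packings n k (suc x)
  packings-suc-suc n k x = begin
    packings (suc n) (suc k) x
      ≡⟨ ∑-choose-split (outside ∷_) (inside ∷_) k (subsets n) (subsets n) (weight x)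
           (weight-inside-inside x) ⟩
    ∑ (choose (suc k) (subsets n)) (weight x ∘ map (outside ∷_))
      + ∑ (choose k (subsets n))
          (λ bs → ∑ (subsets n) (λ p → weight x (map (outside ∷_) bs ∷ʳ (inside ∷ p))))
      ≡⟨ cong₂ _+_
           (trans (∑-cong (weight-outside x) (choose (suc k) (subsets n)))
                  (∑-*ˡ x (weight x) (choose (suc k) (subsets n))))
           (∑-cong ∑-inside (choose k (subsets n))) ⟩
    x * packings n (suc k) x + packings n k (suc x) ∎
    where
    ∑-inside : ∀ bs →
      ∑ (subsets n) (λ p → weight x (map (outside ∷_) bs ∷ʳ (inside ∷ p))) ≡ weight (suc x) bs
    ∑-inside bs = begin
      _ ≡⟨ ∑-cong (λ p → weight-∷ʳ-inside x p bs) (subsets n) ⟩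
      _ ≡⟨ ∑-*ˡ ⟦ isPacking? bs ⟧ _ (subsets n) ⟩
      _ ≡⟨ cong (⟦ isPacking? bs ⟧ *_) (∑-disjoint x (⋃ bs)) ⟩
      weight (suc x) bs ∎

  -- Stirling numbers as packing numbers at x = 0.

  -- Each uncovered point gives a factor 0, and with none left the empty product `0 ^ 0` is 1.
  ⟦≡⊤⟧ : (u : Subset n) → ⟦ ≡-dec _≟ᵇ_ u ⊤ ⟧ ≡ 0 ^ ∣ ∁ u ∣
  ⟦≡⊤⟧ []            = refl
  ⟦≡⊤⟧ (outside ∷ u) = refl
  ⟦≡⊤⟧ (inside ∷ u)  = trans
    (⟦⟧-⇔ (mk⇔ ∷-injectiveʳ (cong (inside ∷_))) (≡-dec _≟ᵇ_ (inside ∷ u) ⊤) (≡-dec _≟ᵇ_ u ⊤))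
    (⟦≡⊤⟧ u)

  ⟦isPartition⟧ : (bs : List (Subset n)) → ⟦ isPartition? bs ⟧ ≡ weight 0 bs
  ⟦isPartition⟧ bs = begin
    ⟦ isPartition? bs ⟧
      ≡⟨ ⟦⟧-⇔ (mk⇔ (λ (isPartition a b c) → (a , b) , c) (λ ((a , b) , c) → isPartition a b c))
           (isPartition? bs) (isPacking? bs ×-dec ≡-dec _≟ᵇ_ (⋃ bs) ⊤) ⟩
    ⟦ isPacking? bs ×-dec ≡-dec _≟ᵇ_ (⋃ bs) ⊤ ⟧
      ≡⟨ ⟦⟧-× (isPacking? bs) (≡-dec _≟ᵇ_ (⋃ bs) ⊤) ⟩
    ⟦ isPacking? bs ⟧ * ⟦ ≡-dec _≟ᵇ_ (⋃ bs) ⊤ ⟧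
      ≡⟨ cong (⟦ isPacking? bs ⟧ *_) (⟦≡⊤⟧ (⋃ bs)) ⟩
    weight 0 bs ∎

  stirling₂≡packings : ∀ n k → stirling₂ n k ≡ packings n k 0
  stirling₂≡packings n k = trans (length-filter isPartition? (choose k (subsets n)))
    (∑-cong ⟦isPartition⟧ (choose k (subsets n)))

open Packings using (packings; packings-0-suc; packings-suc-0; packings-suc-suc; stirling₂≡packings)

-- Finite differences over a commutative ring.

module FiniteDifferences {c ℓ} (R : CommutativeRing c ℓ) where

  import Algebra.Properties.CommutativeMonoid.Sum
  import Algebra.Properties.Ring
  import Algebra.Properties.Semiring.Exp
  import Algebra.Properties.Semiring.Mult
  import Algebra.Properties.Semiring.Sum
  import Algebra.Solver.Ring.NaturalCoefficients.Default
  open import Data.Fin.Base using (toℕ)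
  open import Data.Nat.Base using (_≤_; z≤n; s≤s)
  open import Data.Nat.Combinatorics using (nCk+nC[k+1]≡[n+1]C[k+1]; k>n⇒nCk≡0)
  import Relation.Binary.Reasoning.Setoid

  open CommutativeRing R
  open Algebra.Properties.CommutativeMonoid.Sum +-commutativeMonoid using (∑-distrib-+)
  open Algebra.Properties.Semiring.Sum semiring using (*-distribˡ-sum)
  open Algebra.Properties.Semiring.Exp semiring using (_^_)
  open Algebra.Properties.Semiring.Mult semiring using (_×_; ×-homo-+; ×1-homo-*)
  open Algebra.Properties.Ring ring using (-1*x≈-x)
  open BoundedSum +-rawMonoid
  open Relation.Binary.Reasoning.Setoid setoid
  open Algebra.Solver.Ring.NaturalCoefficients.Default commutativeSemiring
    using (solve; _:=_; _:+_; _:*_; con)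

  sum≤-cong : ∀ n {f g : ℕ → Carrier} → (∀ j → j ≤ n → f j ≈ g j) → sum≤ n f ≈ sum≤ n g
  sum≤-cong zero    f≈g = +-congʳ (f≈g 0 z≤n)
  sum≤-cong (suc n) f≈g = +-cong (f≈g 0 z≤n) (sum≤-cong n (λ j j≤n → f≈g (suc j) (s≤s j≤n)))

  sum≤-+ : ∀ n (f g : ℕ → Carrier) → ∑[ j ≤ n ] (f j + g j) ≈ sum≤ n f + sum≤ n g
  sum≤-+ n f g = ∑-distrib-+ {suc n} (λ i → f (toℕ i)) (λ i → g (toℕ i))

  sum≤-*ˡ : ∀ n x (f : ℕ → Carrier) → ∑[ j ≤ n ] (x * f j) ≈ x * sum≤ n f
  sum≤-*ˡ n x f = sym (*-distribˡ-sum {suc n} x (λ i → f (toℕ i)))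

  sum≤-last : ∀ n (f : ℕ → Carrier) → sum≤ (suc n) f ≈ sum≤ n f + f (suc n)
  sum≤-last zero    f = trans (+-congˡ (+-identityʳ (f 1))) (+-congʳ (sym (+-identityʳ (f 0))))
  sum≤-last (suc n) f = trans (+-congˡ (sum≤-last n (λ j → f (suc j)))) (sym (+-assoc (f 0) _ _))

  -- The canonical map from the naturals, in a form where `ι (suc n)` unfolds to `1# + ι n`; the
  -- solver calls below rely on this.
  ι : ℕ → Carrier
  ι n = n × 1#

  -- A difference written with the scalar - 1#, so that the Leibniz rule is a semiring identity.
  Δ : ℕ → (ℕ → Carrier) → ℕ → Carrier
  Δ zero    g x = g x
  Δ (suc k) g x = Δ k g (suc x) + - 1# * Δ k g x

  Δ-const : ∀ k a x → Δ (suc k) (λ _ → a) x ≈ 0#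
  Δ-const zero    a x = trans (+-congˡ (-1*x≈-x a)) (-‿inverseʳ a)
  Δ-const (suc k) a x = trans (+-cong (Δ-const k a (suc x)) (*-congˡ (Δ-const k a x)))
                              (trans (+-identityˡ _) (zeroʳ (- 1#)))

  -- Higher differences of a product expand binomially; the factor `ι j` has first difference 1 and
  -- vanishing second difference, so just two terms survive.
  Δ-leibniz : ∀ k g x →
    Δ (suc k) (λ j → ι j * g j) x ≈ ι x * Δ (suc k) g x + ι (suc k) * Δ k g (suc x)
  Δ-leibniz zero g x =
    solve 4 (λ m i a b →
      (con 1 :+ i) :* b :+ m :* (i :* a) := i :* (b :+ m :* a) :+ (con 1 :+ con 0) :* b)
      refl (- 1#) (ι x) (g x) (g (suc x))
  Δ-leibniz (suc k) g x = trans
    (+-cong (Δ-leibniz k g (suc x)) (*-congˡ (Δ-leibniz k g x)))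
    (solve 6 (λ m i l a b c →
        ((con 1 :+ i) :* (c :+ m :* b) :+ (con 1 :+ l) :* c)
          :+ m :* (i :* (b :+ m :* a) :+ (con 1 :+ l) :* b)
      := i :* ((c :+ m :* b) :+ m :* (b :+ m :* a)) :+ (con 1 :+ (con 1 :+ l)) :* (c :+ m :* b))
      refl (- 1#) (ι x) (ι k) (Δ k g x) (Δ k g (suc x)) (Δ k g (suc (suc x))))

  -- Both sides obey the same recurrence: the factor `ι (suc k)` from `Δ-leibniz` turns `k !` into
  -- `suc k !`, and the rest is `packings-suc-suc`. The induction on `n` ranges over all `x` because
  -- the recurrence moves to `suc x`.
  Δ-power : ∀ n k x → Δ k (λ j → ι j ^ n) x ≈ ι (k !) * ι (packings n k x)
  Δ-power zero zero    x = solve 0 (con 1 := (con 1 :+ con 0) :* (con 1 :+ con 0)) refl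
  Δ-power zero (suc k) x = begin
    Δ (suc k) (λ _ → 1#) x                    ≈⟨ Δ-const k 1# x ⟩
    0#                                        ≈⟨ zeroʳ _ ⟨
    ι (suc k !) * 0#                          ≡⟨ ≡.cong (λ m → ι (suc k !) * ι m)
                                                         (packings-0-suc k x) ⟨
    ι (suc k !) * ι (packings 0 (suc k) x)    ∎
  Δ-power (suc n) zero x = begin
    ι x * ι x ^ n
      ≈⟨ *-congˡ (Δ-power n 0 x) ⟩
    ι x * (ι 1 * ι (packings n 0 x))
      ≈⟨ solve 3 (λ a b c → a :* (b :* c) := b :* (a :* c)) refl (ι x) (ι 1) _ ⟩
    ι 1 * (ι x * ι (packings n 0 x))
      ≈⟨ *-congˡ (×1-homo-* x (packings n 0 x)) ⟨
    ι 1 * ι (x ℕ.* packings n 0 x)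
      ≡⟨ ≡.cong (λ m → ι 1 * ι m) (packings-suc-0 n x) ⟨
    ι 1 * ι (packings (suc n) 0 x) ∎
  Δ-power (suc n) (suc k) x = begin
    Δ (suc k) (λ j → ι j * ι j ^ n) x
      ≈⟨ Δ-leibniz k (λ j → ι j ^ n) x ⟩
    ι x * Δ (suc k) (λ j → ι j ^ n) x + ι (suc k) * Δ k (λ j → ι j ^ n) (suc x)
      ≈⟨ +-cong (*-congˡ (Δ-power n (suc k) x)) (*-congˡ (Δ-power n k (suc x))) ⟩
    ι x * (ι (suc k !) * ι p) + ι (suc k) * (ι (k !) * ι q)
      ≈⟨ +-congˡ (*-assoc (ι (suc k)) (ι (k !)) (ι q)) ⟨
    ι x * (ι (suc k !) * ι p) + ι (suc k) * ι (k !) * ι q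
      ≈⟨ +-congˡ (*-congʳ (×1-homo-* (suc k) (k !))) ⟨
    ι x * (ι (suc k !) * ι p) + ι (suc k !) * ι q
      ≈⟨ solve 4 (λ i m a b → i :* (m :* a) :+ m :* b := m :* (i :* a :+ b)) refl
           (ι x) (ι (suc k !)) (ι p) (ι q) ⟩
    ι (suc k !) * (ι x * ι p + ι q)
      ≈⟨ *-congˡ (+-congʳ (×1-homo-* x p)) ⟨
    ι (suc k !) * (ι (x ℕ.* p) + ι q)
      ≈⟨ *-congˡ (×-homo-+ 1# (x ℕ.* p) q) ⟨
    ι (suc k !) * ι (x ℕ.* p ℕ.+ q)
      ≡⟨ ≡.cong (λ m → ι (suc k !) * ι m) (packings-suc-suc n k x) ⟨
    ι (suc k !) * ι (packings (suc n) (suc k) x) ∎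
    where
    p = packings n (suc k) x
    q = packings n k (suc x)

  -- The binomial expansion of (shift minus identity) to the power k, by Pascal's rule.
  Δ-expand : ∀ k g x → Δ k g x ≈ ∑[ j ≤ k ] ((- 1#) ^ (k ∸ j) * ι (k C j) * g (x ℕ.+ j))
  Δ-expand zero g x = begin
    g x
      ≡⟨ ≡.cong g (ℕ.+-identityʳ x) ⟨
    g (x ℕ.+ 0)
      ≈⟨ solve 1 (λ a → a := con 1 :* (con 1 :+ con 0) :* a :+ con 0) refl (g (x ℕ.+ 0)) ⟩
    1# * (1# + 0#) * g (x ℕ.+ 0) + 0# ∎
  Δ-expand (suc k) g x = begin
    Δ k g (suc x) + - 1# * Δ k g x
      ≈⟨ +-cong (Δ-expand k g (suc x)) (*-congˡ (Δ-expand k g x)) ⟩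
    sum≤ k (λ j → (- 1#) ^ (k ∸ j) * ι (k C j) * g (suc x ℕ.+ j)) + - 1# * sum≤ k (term k)
      ≈⟨ +-congʳ (sum≤-cong k (λ j _ → reflexive (upper-suc j))) ⟩
    sum≤ k upper + - 1# * sum≤ k (term k)
      ≈⟨ +-congˡ (sum≤-*ˡ k (- 1#) (term k)) ⟨
    sum≤ k upper + ∑[ j ≤ k ] (- 1# * term k j)
      ≈⟨ +-congˡ (sum≤-cong k lower-neg) ⟩
    sum≤ k upper + sum≤ k lower
      -- Adding `lower (suc k)`, which is 0 because `k C suc k` is, extends the second sum by one
      -- index. Its first term can then be split off, and the others line up with `upper`.
      ≈⟨ +-congˡ (+-identityʳ _) ⟨
    sum≤ k upper + (sum≤ k lower + 0#)
      ≈⟨ +-congˡ (+-congˡ lower-last) ⟨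
    sum≤ k upper + (sum≤ k lower + lower (suc k))
      ≈⟨ +-congˡ (sum≤-last k lower) ⟨
    sum≤ k upper + (lower 0 + sum≤ k (λ j → lower (suc j)))
      ≈⟨ solve 3 (λ a b c → a :+ (b :+ c) := b :+ (a :+ c)) refl (sum≤ k upper) (lower 0) _ ⟩
    lower 0 + (sum≤ k upper + sum≤ k (λ j → lower (suc j)))
      ≈⟨ +-congˡ (sum≤-+ k upper (λ j → lower (suc j))) ⟨
    lower 0 + ∑[ j ≤ k ] (upper j + lower (suc j))
      -- `lower 0` is already the term at index 0, since `k C 0` and `suc k C 0` both compute to 1.
      ≈⟨ +-congˡ (sum≤-cong k (λ j _ → pascal j)) ⟩
    sum≤ (suc k) (term (suc k)) ∎
    where
    term : ℕ → ℕ → Carrier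
    term k j = (- 1#) ^ (k ∸ j) * ι (k C j) * g (x ℕ.+ j)

    upper lower : ℕ → Carrier
    upper j = (- 1#) ^ (k ∸ j) * ι (k C j) * g (x ℕ.+ suc j)
    lower j = (- 1#) ^ (suc k ∸ j) * ι (k C j) * g (x ℕ.+ j)

    upper-suc : ∀ j → (- 1#) ^ (k ∸ j) * ι (k C j) * g (suc x ℕ.+ j) ≡ upper j
    upper-suc j = ≡.cong (λ y → (- 1#) ^ (k ∸ j) * ι (k C j) * g y) (≡.sym (ℕ.+-suc x j))

    lower-neg : ∀ j → j ≤ k → - 1# * term k j ≈ lower j
    lower-neg j j≤k = begin
      - 1# * term k j
        ≈⟨ solve 4 (λ m a b c → m :* (a :* b :* c) := m :* a :* b :* c) refl
             (- 1#) ((- 1#) ^ (k ∸ j)) (ι (k C j)) (g (x ℕ.+ j)) ⟩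
      (- 1#) ^ suc (k ∸ j) * ι (k C j) * g (x ℕ.+ j)
        -- Subtraction is truncated, so `suc k ∸ j` is `suc (k ∸ j)` only while `j ≤ k`.
        ≡⟨ ≡.cong (λ e → (- 1#) ^ e * ι (k C j) * g (x ℕ.+ j)) (ℕ.+-∸-assoc 1 j≤k) ⟨
      lower j ∎

    lower-last : lower (suc k) ≈ 0#
    lower-last = begin
      lower (suc k)
        ≡⟨ ≡.cong (λ m → (- 1#) ^ (k ∸ k) * ι m * g (x ℕ.+ suc k)) (k>n⇒nCk≡0 (ℕ.n<1+n k)) ⟩
      (- 1#) ^ (k ∸ k) * 0# * g (x ℕ.+ suc k) ≈⟨ *-congʳ (zeroʳ _) ⟩
      0# * g (x ℕ.+ suc k)                    ≈⟨ zeroˡ _ ⟩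
      0#                                      ∎

    pascal : ∀ j → upper j + lower (suc j) ≈ term (suc k) (suc j)
    pascal j = begin
      s * ι (k C j) * y + s * ι (k C suc j) * y
        ≈⟨ solve 4 (λ s a b y → s :* a :* y :+ s :* b :* y := s :* (a :+ b) :* y) refl
             s (ι (k C j)) (ι (k C suc j)) y ⟩
      s * (ι (k C j) + ι (k C suc j)) * y
        ≈⟨ *-congʳ (*-congˡ (×-homo-+ 1# (k C j) (k C suc j))) ⟨
      s * ι (k C j ℕ.+ k C suc j) * y
        ≡⟨ ≡.cong (λ m → s * ι m * y) (nCk+nC[k+1]≡[n+1]C[k+1] k j) ⟩
      term (suc k) (suc j) ∎
      where
      s = (- 1#) ^ (k ∸ j)
      y = g (x ℕ.+ suc j)

  -- Natural-number sums and Lucas numbers inside the ring.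

  ι-sum≤ : ∀ n (f : ℕ → ℕ) →
    ι (BoundedSum.sum≤ ℕ.+-0-rawMonoid n f) ≈ ∑[ k ≤ n ] ι (f k)
  ι-sum≤ zero    f = ×-homo-+ 1# (f 0) 0
  ι-sum≤ (suc n) f = trans (×-homo-+ 1# (f 0) _) (+-congˡ (ι-sum≤ n (λ k → f (suc k))))

  -- Powers of a root of t² = t + 1 satisfy the Lucas recurrence, hence so does the sum of two such
  -- powers; the initial values 2 and 1 are the sums of the zeroth and first powers.
  lucas-binet : ∀ {x y} → x * x ≈ x + 1# → y * y ≈ y + 1# → x + y ≈ 1# →
    ∀ m → ι (lucas m) ≈ x ^ m + y ^ m
  lucas-binet x² y² x+y 0 = +-congˡ (+-identityʳ 1#)
  lucas-binet {x} {y} x² y² x+y 1 = begin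
    1# + 0#               ≈⟨ +-identityʳ 1# ⟩
    1#                    ≈⟨ x+y ⟨
    x + y                 ≈⟨ +-cong (*-identityʳ x) (*-identityʳ y) ⟨
    x * 1# + y * 1#       ∎
  lucas-binet {x} {y} x² y² x+y (suc (suc m)) = begin
    ι (lucas (suc m) ℕ.+ lucas m)
      ≈⟨ ×-homo-+ 1# (lucas (suc m)) (lucas m) ⟩
    ι (lucas (suc m)) + ι (lucas m)
      ≈⟨ +-cong (lucas-binet x² y² x+y (suc m)) (lucas-binet x² y² x+y m) ⟩
    x * x ^ m + y * y ^ m + (x ^ m + y ^ m)
      ≈⟨ solve 4 (λ x y a b → x :* a :+ y :* b :+ (a :+ b) := (x :+ con 1) :* a :+ (y :+ con 1) :* b)
           refl x y (x ^ m) (y ^ m) ⟩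
    (x + 1#) * x ^ m + (y + 1#) * y ^ m
      ≈⟨ +-cong (*-congʳ x²) (*-congʳ y²) ⟨
    x * x * x ^ m + y * y * y ^ m
      ≈⟨ +-cong (*-assoc x x (x ^ m)) (*-assoc y y (y ^ m)) ⟩
    x ^ suc (suc m) + y ^ suc (suc m) ∎

-- Arithmetic of the embedded naturals and of division in ℚ(√5).

open import Data.Integer.Base using (+_; 1ℤ)
open import Data.Integer.Solver using (module +-*-Solver)
open import Data.Nat.Base using (NonZero)
open import Data.Rational.Base as ℚ using (1ℚ; toℚᵘ; fromℚᵘ)
import Data.Rational.Properties as ℚ
open import Data.Rational.Unnormalised.Base as ℚᵘ using (mkℚᵘ; *≡*)
import Data.Rational.Unnormalised.Properties as ℚᵘ
open import Relation.Binary.PropositionalEquality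
  using (refl; sym; trans; cong; cong₂; module ≡-Reasoning)
open import Defs

open CommutativeRing ℚ[√5]-commutativeRing
  using (*-identityʳ; *-assoc)
open FiniteDifferences ℚ[√5]-commutativeRing
  using (ι; Δ; Δ-power; Δ-expand; ι-sum≤; sum≤-cong; sum≤-*ˡ; lucas-binet)
open import Algebra.Properties.Semiring.Mult (CommutativeRing.semiring ℚ[√5]-commutativeRing)
  using (×1-homo-*)
open import Algebra.Properties.CommutativeSemigroup
  (CommutativeRing.*-commutativeSemigroup ℚ[√5]-commutativeRing)
  using (xy∙z≈y∙xz)

-- Reduction to lowest terms does not compute for a variable `n`, so the equation is checked by
-- cross-multiplying unnormalised fractions. The second argument of `mkℚᵘ` is the denominator minus
-- one.
[1+n]/1 : ∀ n → + suc n ℚ./ 1 ≡ 1ℚ ℚ.+ (+ n ℚ./ 1)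
[1+n]/1 n = ℚ.toℚᵘ-injective (begin
  toℚᵘ (fromℚᵘ (mkℚᵘ (+ suc n) 0))
    ≈⟨ ℚ.toℚᵘ-fromℚᵘ (mkℚᵘ (+ suc n) 0) ⟩
  mkℚᵘ (+ suc n) 0
    ≈⟨ *≡* (solve 1 (λ m → (con 1ℤ :+ m) :* con 1ℤ := (con 1ℤ :* con 1ℤ :+ m :* con 1ℤ) :* con 1ℤ)
             refl (+ n)) ⟩
  mkℚᵘ 1ℤ 0 ℚᵘ.+ mkℚᵘ (+ n) 0
    ≈⟨ ℚᵘ.+-congʳ (mkℚᵘ 1ℤ 0) (ℚ.toℚᵘ-fromℚᵘ (mkℚᵘ (+ n) 0)) ⟨
  toℚᵘ 1ℚ ℚᵘ.+ toℚᵘ (fromℚᵘ (mkℚᵘ (+ n) 0))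
    ≈⟨ ℚ.toℚᵘ-homo-+ 1ℚ (+ n ℚ./ 1) ⟨
  toℚᵘ (1ℚ ℚ.+ (+ n ℚ./ 1)) ∎)
  where
  open ℚᵘ.≃-Reasoning
  open +-*-Solver

1/n*n≡1 : ∀ n .{{_ : NonZero n}} → (1ℤ ℚ./ n) ℚ.* (+ n ℚ./ 1) ≡ 1ℚ
1/n*n≡1 (suc n) = ℚ.toℚᵘ-injective (begin
  toℚᵘ (fromℚᵘ p ℚ.* fromℚᵘ q)
    ≈⟨ ℚ.toℚᵘ-homo-* (fromℚᵘ p) (fromℚᵘ q) ⟩
  toℚᵘ (fromℚᵘ p) ℚᵘ.* toℚᵘ (fromℚᵘ q)
    ≈⟨ ℚᵘ.*-cong (ℚ.toℚᵘ-fromℚᵘ p) (ℚ.toℚᵘ-fromℚᵘ q) ⟩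
  p ℚᵘ.* q
    ≈⟨ *≡* (solve 1 (λ m → con 1ℤ :* m :* con 1ℤ := con 1ℤ :* (m :* con 1ℤ)) refl (+ suc n)) ⟩
  toℚᵘ 1ℚ ∎)
  where
  open ℚᵘ.≃-Reasoning
  open +-*-Solver
  p = mkℚᵘ 1ℤ n
  q = mkℚᵘ (+ suc n) 0

fromℕ≡ι : ∀ n → fromℕ n ≡ ι n
fromℕ≡ι zero    = refl
fromℕ≡ι (suc n) = trans (cong fromℚ ([1+n]/1 n)) (cong (λ x → 1# + x) (fromℕ≡ι n))

fromℚ-* : ∀ p q → fromℚ p * fromℚ q ≡ fromℚ (p ℚ.* q)
fromℚ-* p q = cong₂ _+√5·_
  (ℚ.+-identityʳ (p ℚ.* q))
  (cong₂ ℚ._+_ (ℚ.*-zeroʳ p) (ℚ.*-zeroˡ q))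

/-*-cancel : ∀ x n .{{_ : NonZero n}} → x / n * fromℕ n ≡ x
/-*-cancel x n = begin
  x * fromℚ (1ℤ ℚ./ n) * fromℕ n          ≡⟨ *-assoc x _ _ ⟩
  x * (fromℚ (1ℤ ℚ./ n) * fromℕ n)        ≡⟨ cong (x *_) (fromℚ-* (1ℤ ℚ./ n) (+ n ℚ./ 1)) ⟩
  x * fromℚ ((1ℤ ℚ./ n) ℚ.* (+ n ℚ./ 1))  ≡⟨ cong (λ p → x * fromℚ p) (1/n*n≡1 n) ⟩
  x * 1#                                  ≡⟨ *-identityʳ x ⟩
  x                                       ∎
  where open ≡-Reasoning

-- Lucas and Stirling numbers in ℚ(√5), and the double sum.

lucas-αβ : ∀ m → fromℕ (lucas m) ≡ α ^ m + β ^ m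
-- The three `refl` are the closed computations α² = α + 1, β² = β + 1 and α + β = 1.
lucas-αβ m = trans (fromℕ≡ι (lucas m)) (lucas-binet {α} {β} refl refl refl m)

-- The inclusion-exclusion count of surjections from an n-set onto a k-set, obtained by evaluating
-- the k-th difference of the n-th power at 0 in two ways.
∑-alternating : ∀ n k → ∑[ j ≤ k ] ((- 1#) ^ (k ∸ j) * fromℕ (k C j) * fromℕ j ^ n) ≡
  fromℕ (k !) * fromℕ (stirling₂ n k)
∑-alternating n k = begin
  ∑[ j ≤ k ] ((- 1#) ^ (k ∸ j) * fromℕ (k C j) * fromℕ j ^ n)
    ≡⟨ sum≤-cong k (λ j _ → cong₂ (λ c x → (- 1#) ^ (k ∸ j) * c * x ^ n)
                                (fromℕ≡ι (k C j)) (fromℕ≡ι j)) ⟩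
  ∑[ j ≤ k ] ((- 1#) ^ (k ∸ j) * ι (k C j) * ι j ^ n)
    ≡⟨ Δ-expand k (λ j → ι j ^ n) 0 ⟨
  Δ k (λ j → ι j ^ n) 0
    ≡⟨ Δ-power n k 0 ⟩
  ι (k !) * ι (packings n k 0)
    ≡⟨ cong₂ _*_ (fromℕ≡ι (k !))
         (trans (cong fromℕ (stirling₂≡packings n k)) (fromℕ≡ι (packings n k 0))) ⟨
  fromℕ (k !) * fromℕ (stirling₂ n k) ∎
  where open ≡-Reasoning

theorem2 : (n : ℕ) →
    fromℕ (lucasFubini n) ≡
    ∑[ k ≤ n ] (∑[ j ≤ k ] (let instance _ = k !≢0 in
    (- 1#) ^ (k ∸ j) * fromℕ (k C j) * ((α ^ suc k + β ^ suc k) / (k !)) * fromℕ j ^ n))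
theorem2 n = begin
  fromℕ (lucasFubini n)
    ≡⟨ fromℕ≡ι (lucasFubini n) ⟩
  ι (lucasFubini n)
    ≡⟨ ι-sum≤ n (λ k → lucas (suc k) ℕ.* stirling₂ n k) ⟩
  ∑[ k ≤ n ] ι (lucas (suc k) ℕ.* stirling₂ n k)
    ≡⟨ sum≤-cong n (λ k _ → summand k) ⟩
  _ ∎
  where
  open ≡-Reasoning
  summand : ∀ k → ι (lucas (suc k) ℕ.* stirling₂ n k) ≡
    ∑[ j ≤ k ] (let instance _ = k !≢0 in
      (- 1#) ^ (k ∸ j) * fromℕ (k C j) * ((α ^ suc k + β ^ suc k) / (k !)) * fromℕ j ^ n)
  summand k = begin
    ι (lucas (suc k) ℕ.* stirling₂ n k)
      ≡⟨ ×1-homo-* (lucas (suc k)) (stirling₂ n k) ⟩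
    ι (lucas (suc k)) * ι (stirling₂ n k)
      ≡⟨ cong₂ _*_ (fromℕ≡ι (lucas (suc k))) (fromℕ≡ι (stirling₂ n k)) ⟨
    fromℕ (lucas (suc k)) * fromℕ (stirling₂ n k)
      -- Multiplying and dividing by `k !` supplies the factor that `∑-alternating` pairs with the
      -- Stirling number.
      ≡⟨ cong (_* fromℕ (stirling₂ n k)) (trans (lucas-αβ (suc k)) (sym (/-*-cancel _ (k !)))) ⟩
    coefficient * fromℕ (k !) * fromℕ (stirling₂ n k)
      ≡⟨ *-assoc coefficient (fromℕ (k !)) (fromℕ (stirling₂ n k)) ⟩
    coefficient * (fromℕ (k !) * fromℕ (stirling₂ n k))
      ≡⟨ cong (coefficient *_) (∑-alternating n k) ⟨
    coefficient * ∑[ j ≤ k ] (sign j * fromℕ j ^ n)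
      ≡⟨ sum≤-*ˡ k coefficient (λ j → sign j * fromℕ j ^ n) ⟨
    ∑[ j ≤ k ] (coefficient * (sign j * fromℕ j ^ n))
      ≡⟨ sum≤-cong k (λ j _ → sym (xy∙z≈y∙xz (sign j) coefficient (fromℕ j ^ n))) ⟩
    ∑[ j ≤ k ] (sign j * coefficient * fromℕ j ^ n) ∎
    where
    instance _ = k !≢0
    coefficient = (α ^ suc k + β ^ suc k) / (k !)
    sign : ℕ → ℚ[√5]
    sign j = (- 1#) ^ (k ∸ j) * fromℕ (k C j)
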